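{- Let $G=(V,E)$ be a connected simple pfaffian graph which has no $4$-cycles. Let $G'=(V,E')$ be the graph on the same vertex set in which two distinct vertices $u,v$ are adjacent if and only if there is a path of length $2$ between $u$ and $v$ in $G$. Let $M'$ be a matching in $G'$, and let $V(M')$ be the set of vertices covered by $M'$. Then the number $\operatorname{perfmat} G$ of perfect matchings of $G$ satisfies $$\operatorname{perfmat} G\le\Bigl(\prod_{(u,v)\in M'}\bigl(d(u)d(v)-1\bigr)\Bigr)^{\frac14}\Bigl(\prod_{v\in V\setminus V(M')}d(v)\Bigr)^{\frac14},$$ where $d(v)$ denotes the degree of $v$ in $G$.
   Context: Graphs are finite. For an orientation of the edges of $G$, the skew symmetric adjacency matrix is $S(G)=[s_{uv}]_{u,v\in V}$ with $s_{uv}=1$ if the edge $(u,v)\in E$ is oriented from $u$ to $v$, $s_{uv}=-1$ if it is oriented from $v$ to $u$, and $s_{uv}=0$ if $(u,v)\notin E$. $G$ is pfaffian if it has an orientation with $\det S(G)=(\operatorname{perfmat} G)^2$. A matching is a (not necessarily perfect) set of pairwise disjoint edges. The length of a path is its number of edges; "no $4$-cycles" means that $G$ contains no cycle of length $4$ as a subgraph. -}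

module Defs where

open import Algebra.Properties.Semiring.Sum using (sum)
open import Data.Bool using (if_then_else_)
open import Data.Fin using (Fin; zero; suc; toℕ; punchIn; _<?_; _≟_)
open import Data.Fin.Properties using (any?; all?)
open import Data.Integer using (ℤ; +_; 0ℤ; 1ℤ; -1ℤ; _*_; _^_)
open import Data.Integer.Properties using (+-*-semiring)
open import Data.List using (List; []; _∷_; _++_; map; filter; foldr; length; allFin; cartesianProduct)
open import Data.List.Relation.Unary.All as All using (All; []; _∷_)
open import Data.List.Relation.Unary.AllPairs using (AllPairs; []; _∷_; allPairs?)
open import Data.List.Relation.Unary.Any as Any using (Any)
open import Data.List.Relation.Unary.Linked using (Linked; [-]; _∷_; linked?)
open import Data.List.Relation.Unary.Unique.Propositional using (Unique)
open import Data.Nat using (ℕ) renaming (zero to ℕzero; suc to ℕsuc; _^_ to _^ℕ_)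
open import Data.Product using (_×_; _,_; ∃-syntax; Σ)
open import Data.Sum using (_⊎_)
open import Level using (0ℓ)
open import Relation.Binary using (Rel; Symmetric; Irreflexive; Asymmetric; Decidable)
open import Relation.Binary.Construct.Closure.ReflexiveTransitive using (Star)
open import Relation.Binary.PropositionalEquality using (_≡_; _≢_; ≢-sym)
open import Relation.Nullary using (¬_; does; ¬?; _×-dec_; _⊎-dec_)
import Relation.Unary as U

-- Finite simple graphs on the vertex set Fin n.
record Graph (n : ℕ) : Set₁ where
  infix 4 _~_ _~?_
  field
    _~_      : Rel (Fin n) 0ℓ
    ~-sym    : Symmetric _~_
    ~-irrefl : Irreflexive _≡_ _~_
    _~?_     : Decidable _~_

module _ {n : ℕ} (G : Graph n) where
  open Graph G

  deg : Fin n → ℕ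
  deg v = length (filter (v ~?_) (allFin n))

  Connected : Set
  Connected = ∀ u v → Star _~_ u v

  -- A path, given by the list of its vertices; its length is the number of
  -- edges, one less than the length of the list.
  IsPath : List (Fin n) → Set
  IsPath vs = Linked _~_ vs × Unique vs

  isPath? : U.Decidable IsPath
  isPath? vs = linked? _~?_ vs ×-dec allPairs? (λ u v → ¬? (u ≟ v)) vs

  No4Cycles : Set
  No4Cycles = ∀ a b c d → ¬ (IsPath (a ∷ b ∷ c ∷ d ∷ []) × d ~ a)

  pathOfLength2Graph : Graph n
  pathOfLength2Graph = record
    { _~_      = λ u v → u ≢ v × ∃[ w ] IsPath (u ∷ w ∷ v ∷ [])
    ; ~-sym    = λ { (u≢v , w , (uw ∷ wv ∷ [-]) , ((u≢w ∷ _ ∷ []) ∷ (w≢v ∷ []) ∷ [] ∷ [])) →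
                     ≢-sym u≢v , w , (~-sym wv ∷ ~-sym uw ∷ [-])
                   , ((≢-sym w≢v ∷ ≢-sym u≢v ∷ []) ∷ (≢-sym u≢w ∷ []) ∷ [] ∷ []) }
    ; ~-irrefl = λ { u≡v (u≢v , _) → u≢v u≡v }
    ; _~?_     = λ u v → ¬? (u ≟ v) ×-dec any? (λ w → isPath? (u ∷ w ∷ v ∷ []))
    }

-- An edge is represented by a pair of its endpoints, in either order.
Edge : ℕ → Set
Edge n = Fin n × Fin n

module _ {n : ℕ} where

  Incident : Fin n → Edge n → Set
  Incident x (u , v) = x ≡ u ⊎ x ≡ v

  incident? : Decidable Incident
  incident? x (u , v) = (x ≟ u) ⊎-dec (x ≟ v)

  Disjoint : Rel (Edge n) 0ℓ
  Disjoint (u , v) e = ¬ Incident u e × ¬ Incident v e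

  disjoint? : Decidable Disjoint
  disjoint? (u , v) e = ¬? (incident? u e) ×-dec ¬? (incident? v e)

  Covered : List (Edge n) → Fin n → Set
  Covered M v = Any (Incident v) M

  covered? : (M : List (Edge n)) → U.Decidable (Covered M)
  covered? M v = Any.any? (incident? v) M

  uncovered : List (Edge n) → List (Fin n)
  uncovered M = filter (λ v → ¬? (covered? M v)) (allFin n)

module _ {n : ℕ} (G : Graph n) where
  open Graph G

  -- Pairwise disjointness already excludes listing an edge twice.
  IsMatching : List (Edge n) → Set
  IsMatching M = All (λ (u , v) → u ~ v) M × AllPairs Disjoint M

  IsPerfectMatching : List (Edge n) → Set
  IsPerfectMatching M = IsMatching M × (∀ v → Covered M v)

  isPerfectMatching? : U.Decidable IsPerfectMatching
  isPerfectMatching? M =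
    (All.all? (λ (u , v) → u ~? v) M ×-dec allPairs? disjoint? M) ×-dec all? (covered? M)

  -- Each edge occurs exactly once, as the pair (u , v) with u < v.
  edges : List (Edge n)
  edges = filter (λ (u , v) → (u <? v) ×-dec (u ~? v)) (cartesianProduct (allFin n) (allFin n))

-- For a list without repetitions, every subset of its elements occurs exactly once.
sublists : ∀ {A : Set} → List A → List (List A)
sublists []       = [] ∷ []
sublists (x ∷ xs) = map (x ∷_) (sublists xs) ++ sublists xs

-- The number of sets of edges of G that are perfect matchings.
perfmat : ∀ {n} → Graph n → ℕ
perfmat G = length (filter (isPerfectMatching? G) (sublists (edges G)))

Matrix : ℕ → Set
Matrix n = Fin n → Fin n → ℤ

-- Laplace expansion along the first row.
det : ∀ {n} → Matrix n → ℤ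
det {ℕzero}  A = 1ℤ
det {ℕsuc n} A =
  sum +-*-semiring (λ j → -1ℤ ^ toℕ j * A zero j * det (λ i k → A (suc i) (punchIn j k)))

record Orientation {n : ℕ} (G : Graph n) : Set₁ where
  open Graph G
  infix 4 _⇒_ _⇒?_
  field
    _⇒_    : Rel (Fin n) 0ℓ
    ⇒-edge : ∀ {u v} → u ⇒ v → u ~ v
    ⇒-some : ∀ {u v} → u ~ v → u ⇒ v ⊎ v ⇒ u
    ⇒-asym : Asymmetric _⇒_
    _⇒?_   : Decidable _⇒_

  skewAdjacency : Matrix n
  skewAdjacency u v =
    if does (u ⇒? v) then 1ℤ else
    if does (v ⇒? u) then -1ℤ else 0ℤ

open Orientation public using (skewAdjacency)

Pfaffian : ∀ {n} → Graph n → Set₁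
Pfaffian G = Σ (Orientation G) λ O → det (skewAdjacency O) ≡ + (perfmat G ^ℕ 2)

∏ : ∀ {A : Set} → List A → (A → ℤ) → ℤ
∏ xs f = foldr (λ x p → f x * p) 1ℤ xs

{-# OPTIONS --safe #-}

-- (perfmat G)⁴ = (det S)², and (det S)² is at most the squared norm of the wedge
-- product of the rows of S, taken in any order.  For a vector v and any ω in the
-- exterior algebra |v ∧ ω|² + |ι_v ω|² = |v|² |ω|², so each row v costs a factor
-- |v|² = d(v).  For a pair u, v of M′, replacing the row v by |u|² v − ⟨u,v⟩ u
-- improves the factor d(u) d(v) to |u|² |v|² − ⟨u,v⟩², and ⟨u,v⟩ = ±1 because
-- without 4-cycles u and v have exactly one common neighbour.
module Submission where

open import Defs
open import Algebra.Properties.Semiring.Sum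
  using (sum; *-distribˡ-sum; sum-cong-≗; sum-remove; sum-replicate-zero)
open import Data.Bool using (Bool; true; false; if_then_else_)
open import Data.Empty using (⊥-elim)
open import Data.Fin using (Fin; zero; suc; toℕ; punchIn; _≟_)
open import Data.Fin.Properties using (punchInᵢ≢i)
open import Data.Integer
  using (ℤ; +_; -[1+_]; 0ℤ; 1ℤ; -1ℤ; _+_; _*_; -_; _-_; _^_; _≤_; _<_; +≤+; +<+; positive; nonNegative)
open import Data.Integer.Properties
  using (+-*-semiring; +-identityˡ; +-identityʳ; *-zeroʳ; *-identityˡ; *-assoc; pos-*; +-mono-≤;
         ≤-refl; ≤-reflexive; <⇒≤; i≤i+j; i≤j⇒0≤j-i; *-cancelˡ-≤-pos; *-monoˡ-≤-nonNeg; module ≤-Reasoning)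
open import Data.Integer.Tactic.RingSolver using (solve-∀)
open import Data.List using (List; []; _∷_; _++_; map; filter; foldr; length; allFin; tabulate)
open import Data.List.Membership.Propositional using (_∈_)
open import Data.List.Membership.Propositional.Properties
  using (∈-++⁺ˡ; ∈-++⁺ʳ; ∈-filter⁺; ∈-filter⁻; ∈-allFin; ∈-length)
open import Data.List.Membership.Propositional.Properties.WithK using (unique∧set⇒bag)
open import Data.List.Properties using (map-tabulate)
open import Data.List.Relation.Binary.BagAndSetEquality using (∼bag⇒↭)
open import Data.List.Relation.Binary.Permutation.Propositional as ↭ using (_↭_)
open import Data.List.Relation.Binary.Permutation.Propositional.Properties using (map⁺)
open import Data.List.Relation.Unary.All as All using (All; []; _∷_)
open import Data.List.Relation.Unary.All.Properties using (¬Any⇒All¬; All¬⇒¬Any)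
open import Data.List.Relation.Unary.AllPairs using (AllPairs; []; _∷_)
open import Data.List.Relation.Unary.Any using (here; there)
open import Data.List.Relation.Unary.Linked using ([-]; _∷_)
open import Data.List.Relation.Unary.Unique.Propositional using (Unique)
import Data.List.Relation.Unary.Unique.Propositional.Properties as Unique
open import Data.Nat as ℕ using (ℕ; zero; suc)
import Data.Nat.Properties as ℕ
open import Data.Product using (_×_; _,_; proj₁; proj₂)
open import Data.Sum using (_⊎_; inj₁; inj₂)
open import Function using (_∘_; mk⇔)
open import Relation.Binary.PropositionalEquality
  using (_≡_; _≢_; refl; sym; trans; cong; cong₂; subst; ≢-sym; module ≡-Reasoning)
open import Relation.Nullary using (¬_; yes; no; does; ¬?)
open import Relation.Nullary.Decidable using (decidable-stable; dec-false)
open import Relation.Unary using (Pred; Decidable)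

-- The exterior algebra in coordinates: wedge, contraction, inner product.

Vector : ℕ → Set
Vector n = Fin n → ℤ

dot : ∀ {n} → Vector n → Vector n → ℤ
dot v w = sum +-*-semiring (λ i → v i * w i)

-- The exterior algebra of ℤⁿ: the pair (α , β) stands for α + e₀ ∧ β, where
-- α and β do not involve the first basis vector e₀.
Λ : ℕ → Set
Λ zero    = ℤ
Λ (suc n) = Λ n × Λ n

-- The combination a x + b y. Sums, multiples and negation are all instances of it, so one linearity
-- lemma per operation suffices.
lin : ∀ {n} → ℤ → ℤ → Λ n → Λ n → Λ n
lin {zero}  a b x y = a * x + b * y
lin {suc n} a b (x₀ , x₁) (y₀ , y₁) = lin a b x₀ y₀ , lin a b x₁ y₁

zeroΛ oneΛ : ∀ {n} → Λ n
zeroΛ {zero}  = 0ℤ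
zeroΛ {suc n} = zeroΛ , zeroΛ
oneΛ {zero}  = 1ℤ
oneΛ {suc n} = oneΛ , zeroΛ

infix 8 ⊖_
⊖_ : ∀ {n} → Λ n → Λ n
⊖ x = lin -1ℤ 0ℤ x x

infixr 7 _∧_
-- With v = v₀ e₀ + v′, the product is v′ ∧ α + e₀ ∧ (v₀ α - v′ ∧ β); the sign comes from moving v′
-- past e₀.
_∧_ : ∀ {n} → Vector n → Λ n → Λ n
_∧_ {zero}  v x       = 0ℤ
_∧_ {suc n} v (α , β) = v′ ∧ α , lin (v zero) -1ℤ α (v′ ∧ β)
  where v′ = v ∘ suc

-- Contraction with v, the antiderivation sending each basis vector to the matching coordinate of v:
-- e₀ ∧ β goes to v₀ β - e₀ ∧ ι v′ β.
ι : ∀ {n} → Vector n → Λ n → Λ n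
ι {zero}  v x       = 0ℤ
ι {suc n} v (α , β) = lin 1ℤ (v zero) (ι v′ α) β , ⊖ ι v′ β
  where v′ = v ∘ suc

⋀ : ∀ {n} → List (Vector n) → Λ n
⋀ = foldr _∧_ oneΛ

-- The inner product for which the increasing products of basis vectors are orthonormal.
⟪_,_⟫ : ∀ {n} → Λ n → Λ n → ℤ
⟪_,_⟫ {zero}  x y = x * y
⟪_,_⟫ {suc n} (α , β) (γ , δ) = ⟪ α , γ ⟫ + ⟪ β , δ ⟫

normSq : ∀ {n} → Λ n → ℤ
normSq x = ⟪ x , x ⟫

-- Bilinearity and anticommutativity of the wedge product.

lin-interchange : ∀ {n} a b c d (x y z w : Λ n) →
  lin a b (lin c d x y) (lin c d z w) ≡ lin c d (lin a b x z) (lin a b y w)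
lin-interchange {zero} = base
  where
  base : ∀ a b c d (x y z w : ℤ) →
    a * (c * x + d * y) + b * (c * z + d * w) ≡ c * (a * x + b * z) + d * (a * y + b * w)
  base = solve-∀
lin-interchange {suc n} a b c d (x , x′) (y , y′) (z , z′) (w , w′) =
  cong₂ _,_ (lin-interchange a b c d x y z w) (lin-interchange a b c d x′ y′ z′ w′)

lin-zeroΛ : ∀ {n} a b → lin a b zeroΛ zeroΛ ≡ zeroΛ {n}
lin-zeroΛ {zero}  = base
  where
  base : ∀ a b → a * 0ℤ + b * 0ℤ ≡ 0ℤ
  base = solve-∀
lin-zeroΛ {suc n} a b = cong₂ _,_ (lin-zeroΛ a b) (lin-zeroΛ a b)

∧-lin : ∀ {n} (v : Vector n) a b (x y : Λ n) → v ∧ lin a b x y ≡ lin a b (v ∧ x) (v ∧ y)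
∧-lin {zero}  v a b x y = sym (lin-zeroΛ a b)
∧-lin {suc n} v a b (α , β) (γ , δ) = cong₂ _,_ (∧-lin _ a b α γ) (begin
  lin (v zero) -1ℤ (lin a b α γ) (v′ ∧ lin a b β δ)            ≡⟨ cong (lin _ _ _) (∧-lin v′ a b β δ) ⟩
  lin (v zero) -1ℤ (lin a b α γ) (lin a b (v′ ∧ β) (v′ ∧ δ))   ≡⟨ lin-interchange (v zero) -1ℤ a b _ _ _ _ ⟩
  lin a b (lin (v zero) -1ℤ α (v′ ∧ β)) (lin (v zero) -1ℤ γ (v′ ∧ δ)) ∎)
  where
  open ≡-Reasoning
  v′ = v ∘ suc

lin-∧ : ∀ {n} a b (v w : Vector n) (x : Λ n) →
  (λ i → a * v i + b * w i) ∧ x ≡ lin a b (v ∧ x) (w ∧ x)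
lin-∧ {zero}  a b v w x = sym (lin-zeroΛ a b)
lin-∧ {suc n} a b v w (α , β) = cong₂ _,_ (lin-∧ a b v′ w′ α)
  (trans (cong (lin _ _ _) (lin-∧ a b v′ w′ β)) (lemma (v zero) (w zero) α (v′ ∧ β) (w′ ∧ β)))
  where
  v′ = v ∘ suc
  w′ = w ∘ suc
  base : ∀ a b s t x y z → (a * s + b * t) * x + -1ℤ * (a * y + b * z) ≡
    a * (s * x + -1ℤ * y) + b * (t * x + -1ℤ * z)
  base = solve-∀
  -- `lin` acts coordinatewise, so the integer identity `base` lifts to `Λ n` by recursion; the
  -- later lemmas of this shape do the same.
  lemma : ∀ {n} s t (x y z : Λ n) →
    lin (a * s + b * t) -1ℤ x (lin a b y z) ≡ lin a b (lin s -1ℤ x y) (lin t -1ℤ x z)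
  lemma {zero} s t x y z = base a b s t x y z
  lemma {suc n} s t (x , x′) (y , y′) (z , z′) = cong₂ _,_ (lemma s t x y z) (lemma s t x′ y′ z′)

-- In the e₀ part the two terms v₀ (v′ ∧ α) cancel, and v′ ∧ v′ ∧ β vanishes by induction.
∧-self : ∀ {n} (v : Vector n) (x : Λ n) → v ∧ v ∧ x ≡ zeroΛ
∧-self {zero}  v x = refl
∧-self {suc n} v (α , β) = cong₂ _,_ (∧-self v′ α) (begin
  lin a -1ℤ (v′ ∧ α) (v′ ∧ lin a -1ℤ α (v′ ∧ β))            ≡⟨ cong (lin _ _ _) (∧-lin v′ a -1ℤ α _) ⟩
  lin a -1ℤ (v′ ∧ α) (lin a -1ℤ (v′ ∧ α) (v′ ∧ v′ ∧ β))
    ≡⟨ cong (λ y → lin a -1ℤ (v′ ∧ α) (lin a -1ℤ (v′ ∧ α) y)) (∧-self v′ β) ⟩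
  lin a -1ℤ (v′ ∧ α) (lin a -1ℤ (v′ ∧ α) zeroΛ)             ≡⟨ lemma (v′ ∧ α) ⟩
  zeroΛ                                                      ∎)
  where
  open ≡-Reasoning
  v′ = v ∘ suc
  a = v zero
  base : ∀ a x → a * x + -1ℤ * (a * x + -1ℤ * 0ℤ) ≡ 0ℤ
  base = solve-∀
  lemma : ∀ {n} (x : Λ n) → lin a -1ℤ x (lin a -1ℤ x zeroΛ) ≡ zeroΛ
  lemma {zero}  x = base a x
  lemma {suc n} (x , x′) = cong₂ _,_ (lemma x) (lemma x′)

∧-anticomm : ∀ {n} (v w : Vector n) (x : Λ n) → v ∧ w ∧ x ≡ ⊖ (w ∧ v ∧ x)
∧-anticomm {zero}  v w x = refl
∧-anticomm {suc n} v w (α , β) = cong₂ _,_ (∧-anticomm v′ w′ α) (begin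
  lin a -1ℤ (w′ ∧ α) (v′ ∧ lin b -1ℤ α (w′ ∧ β))              ≡⟨ cong (lin _ _ _) (∧-lin v′ b -1ℤ α _) ⟩
  lin a -1ℤ (w′ ∧ α) (lin b -1ℤ (v′ ∧ α) (v′ ∧ w′ ∧ β))
    ≡⟨ cong (λ y → lin a -1ℤ (w′ ∧ α) (lin b -1ℤ (v′ ∧ α) y)) (∧-anticomm v′ w′ β) ⟩
  lin a -1ℤ (w′ ∧ α) (lin b -1ℤ (v′ ∧ α) (⊖ (w′ ∧ v′ ∧ β)))   ≡⟨ lemma (w′ ∧ α) (v′ ∧ α) (w′ ∧ v′ ∧ β) ⟩
  ⊖ lin b -1ℤ (v′ ∧ α) (lin a -1ℤ (w′ ∧ α) (w′ ∧ v′ ∧ β))     ≡⟨ cong (λ y → ⊖ lin b -1ℤ (v′ ∧ α) y) (∧-lin w′ a -1ℤ α _) ⟨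
  ⊖ lin b -1ℤ (v′ ∧ α) (w′ ∧ lin a -1ℤ α (v′ ∧ β))            ∎)
  where
  open ≡-Reasoning
  v′ = v ∘ suc
  w′ = w ∘ suc
  a = v zero
  b = w zero
  base : ∀ a b x y z → a * x + -1ℤ * (b * y + -1ℤ * (-1ℤ * z + 0ℤ * z)) ≡
    -1ℤ * (b * y + -1ℤ * (a * x + -1ℤ * z)) + 0ℤ * (b * y + -1ℤ * (a * x + -1ℤ * z))
  base = solve-∀
  lemma : ∀ {n} (x y z : Λ n) → lin a -1ℤ x (lin b -1ℤ y (⊖ z)) ≡ ⊖ lin b -1ℤ y (lin a -1ℤ x z)
  lemma {zero}  x y z = base a b x y z
  lemma {suc n} (x , x′) (y , y′) (z , z′) = cong₂ _,_ (lemma x y z) (lemma x′ y′ z′)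

⊖-involutive : ∀ {n} (x : Λ n) → ⊖ ⊖ x ≡ x
⊖-involutive {zero} = base
  where
  base : ∀ x → -1ℤ * (-1ℤ * x + 0ℤ * x) + 0ℤ * (-1ℤ * x + 0ℤ * x) ≡ x
  base = solve-∀
⊖-involutive {suc n} (x , y) = cong₂ _,_ (⊖-involutive x) (⊖-involutive y)

-- Inner product and squared norm, and their relation to wedge and contraction.

⟪⟫-linˡ : ∀ {n} a b (x y z : Λ n) → ⟪ lin a b x y , z ⟫ ≡ a * ⟪ x , z ⟫ + b * ⟪ y , z ⟫
⟪⟫-linˡ {zero} = base
  where
  base : ∀ a b x y z → (a * x + b * y) * z ≡ a * (x * z) + b * (y * z)
  base = solve-∀
⟪⟫-linˡ {suc n} a b (x , x′) (y , y′) (z , z′) =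
  trans (cong₂ _+_ (⟪⟫-linˡ a b x y z) (⟪⟫-linˡ a b x′ y′ z′)) (regroup a b _ _ _ _)
  where
  regroup : ∀ a b p q r s → (a * p + b * q) + (a * r + b * s) ≡ a * (p + r) + b * (q + s)
  regroup = solve-∀

⟪⟫-comm : ∀ {n} (x y : Λ n) → ⟪ x , y ⟫ ≡ ⟪ y , x ⟫
⟪⟫-comm {zero} = base
  where
  base : ∀ x y → x * y ≡ y * x
  base = solve-∀
⟪⟫-comm {suc n} (x , x′) (y , y′) = cong₂ _+_ (⟪⟫-comm x y) (⟪⟫-comm x′ y′)

⟪⟫-linʳ : ∀ {n} a b (x y z : Λ n) → ⟪ z , lin a b x y ⟫ ≡ a * ⟪ z , x ⟫ + b * ⟪ z , y ⟫
⟪⟫-linʳ a b x y z = trans (⟪⟫-comm z _) (trans (⟪⟫-linˡ a b x y z)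
  (cong₂ (λ p q → a * p + b * q) (⟪⟫-comm x z) (⟪⟫-comm y z)))

normSq-lin : ∀ {n} a b (x y : Λ n) →
  normSq (lin a b x y) ≡ a * a * normSq x + (a * b + a * b) * ⟪ x , y ⟫ + b * b * normSq y
normSq-lin a b x y = begin
  ⟪ lin a b x y , lin a b x y ⟫                                                       ≡⟨ ⟪⟫-linˡ a b x y _ ⟩
  a * ⟪ x , lin a b x y ⟫ + b * ⟪ y , lin a b x y ⟫
    ≡⟨ cong₂ (λ p q → a * p + b * q) (⟪⟫-linʳ a b x y x) (⟪⟫-linʳ a b x y y) ⟩
  a * (a * ⟪ x , x ⟫ + b * ⟪ x , y ⟫) + b * (a * ⟪ y , x ⟫ + b * ⟪ y , y ⟫)
    ≡⟨ cong (λ p → a * (a * ⟪ x , x ⟫ + b * ⟪ x , y ⟫) + b * (a * p + b * ⟪ y , y ⟫)) (⟪⟫-comm y x) ⟩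
  a * (a * ⟪ x , x ⟫ + b * ⟪ x , y ⟫) + b * (a * ⟪ x , y ⟫ + b * ⟪ y , y ⟫)           ≡⟨ expand a b _ _ _ ⟩
  a * a * ⟪ x , x ⟫ + (a * b + a * b) * ⟪ x , y ⟫ + b * b * ⟪ y , y ⟫                 ∎
  where
  open ≡-Reasoning
  expand : ∀ a b p q r → a * (a * p + b * q) + b * (a * q + b * r) ≡ a * a * p + (a * b + a * b) * q + b * b * r
  expand = solve-∀

⟪⟫-zeroΛ : ∀ {n} (x : Λ n) → ⟪ x , zeroΛ ⟫ ≡ 0ℤ
⟪⟫-zeroΛ {zero}  x = *-zeroʳ x
⟪⟫-zeroΛ {suc n} (x , y) = cong₂ _+_ (⟪⟫-zeroΛ x) (⟪⟫-zeroΛ y)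

normSq-lin-zeroΛ : ∀ {n} a b (x : Λ n) → normSq (lin a b x zeroΛ) ≡ a * a * normSq x
normSq-lin-zeroΛ {n} a b x = trans (normSq-lin a b x zeroΛ)
  (trans (cong₂ (λ p q → a * a * normSq x + (a * b + a * b) * p + b * b * q) (⟪⟫-zeroΛ x) (⟪⟫-zeroΛ (zeroΛ {n})))
         (simplify a b (normSq x)))
  where
  simplify : ∀ a b p → a * a * p + (a * b + a * b) * 0ℤ + b * b * 0ℤ ≡ a * a * p
  simplify = solve-∀

normSq-⊖ : ∀ {n} (x : Λ n) → normSq (⊖ x) ≡ normSq x
normSq-⊖ x = trans (normSq-lin -1ℤ 0ℤ x x) (simplify (normSq x))
  where
  simplify : ∀ p → -1ℤ * -1ℤ * p + (-1ℤ * 0ℤ + -1ℤ * 0ℤ) * p + 0ℤ * 0ℤ * p ≡ p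
  simplify = solve-∀

normSq-oneΛ : ∀ {n} → normSq (oneΛ {n}) ≡ 1ℤ
normSq-oneΛ {zero}  = refl
normSq-oneΛ {suc n} = cong₂ _+_ (normSq-oneΛ {n}) (⟪⟫-zeroΛ (zeroΛ {n}))

0≤square : ∀ i → 0ℤ ≤ i * i
0≤square (+ n)    = subst (0ℤ ≤_) (pos-* n n) (+≤+ ℕ.z≤n)
0≤square -[1+ n ] = +≤+ ℕ.z≤n

0≤normSq : ∀ {n} (x : Λ n) → 0ℤ ≤ normSq x
0≤normSq {zero}  x = 0≤square x
0≤normSq {suc n} (x , y) = +-mono-≤ (0≤normSq x) (0≤normSq y)

-- The v₀ terms on both sides pair β with γ, and both carry the same sign from passing e₀ in the
-- remaining e₀ part; the rest is induction.
ι-adjoint : ∀ {n} (v : Vector n) (x y : Λ n) → ⟪ ι v x , y ⟫ ≡ ⟪ x , v ∧ y ⟫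
ι-adjoint {zero}  v x y = sym (*-zeroʳ x)
ι-adjoint {suc n} v (α , β) (γ , δ) = begin
  ⟪ lin 1ℤ a (ι v′ α) β , γ ⟫ + ⟪ ⊖ ι v′ β , δ ⟫
    ≡⟨ cong₂ _+_ (⟪⟫-linˡ 1ℤ a (ι v′ α) β γ) (⟪⟫-linˡ -1ℤ 0ℤ (ι v′ β) (ι v′ β) δ) ⟩
  (1ℤ * ⟪ ι v′ α , γ ⟫ + a * ⟪ β , γ ⟫) + (-1ℤ * ⟪ ι v′ β , δ ⟫ + 0ℤ * ⟪ ι v′ β , δ ⟫)
    ≡⟨ cong₂ (λ p q → (1ℤ * p + a * ⟪ β , γ ⟫) + (-1ℤ * q + 0ℤ * q)) (ι-adjoint v′ α γ) (ι-adjoint v′ β δ) ⟩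
  (1ℤ * ⟪ α , v′ ∧ γ ⟫ + a * ⟪ β , γ ⟫) + (-1ℤ * ⟪ β , v′ ∧ δ ⟫ + 0ℤ * ⟪ β , v′ ∧ δ ⟫)
    ≡⟨ regroup a ⟪ α , v′ ∧ γ ⟫ ⟪ β , γ ⟫ ⟪ β , v′ ∧ δ ⟫ ⟩
  ⟪ α , v′ ∧ γ ⟫ + (a * ⟪ β , γ ⟫ + -1ℤ * ⟪ β , v′ ∧ δ ⟫)
    ≡⟨ cong (_+_ ⟪ α , v′ ∧ γ ⟫) (⟪⟫-linʳ a -1ℤ γ (v′ ∧ δ) β) ⟨
  ⟪ α , v′ ∧ γ ⟫ + ⟪ β , lin a -1ℤ γ (v′ ∧ δ) ⟫                                        ∎
  where
  open ≡-Reasoning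
  v′ = v ∘ suc
  a = v zero
  regroup : ∀ a p q r → (1ℤ * p + a * q) + (-1ℤ * r + 0ℤ * r) ≡ p + (a * q + -1ℤ * r)
  regroup = solve-∀

-- Expanding the two norms gives the cross terms -2 v₀ ⟪ α , v′ ∧ β ⟫ and 2 v₀ ⟪ ι v′ α , β ⟫, which
-- cancel by adjointness. What remains is v₀² (|α|² + |β|²) and the induction hypotheses for α and
-- β.
normSq-∧-ι : ∀ {n} (v : Vector n) (x : Λ n) → normSq (v ∧ x) + normSq (ι v x) ≡ dot v v * normSq x
normSq-∧-ι {zero}  v x = refl
normSq-∧-ι {suc n} v (α , β) = begin
  (P + normSq (lin a -1ℤ α (v′ ∧ β))) + (normSq (lin 1ℤ a (ι v′ α) β) + normSq (⊖ ι v′ β))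
    ≡⟨ cong₂ (λ p q → (P + p) + q) (normSq-lin a -1ℤ α (v′ ∧ β)) (cong₂ _+_ (normSq-lin 1ℤ a (ι v′ α) β) (normSq-⊖ (ι v′ β))) ⟩
  (P + (a * a * A + (a * -1ℤ + a * -1ℤ) * ⟪ α , v′ ∧ β ⟫ + -1ℤ * -1ℤ * Q))
    + ((1ℤ * 1ℤ * R + (1ℤ * a + 1ℤ * a) * ⟪ ι v′ α , β ⟫ + a * a * B) + S)
    ≡⟨ cong (λ c → (P + (a * a * A + (a * -1ℤ + a * -1ℤ) * ⟪ α , v′ ∧ β ⟫ + -1ℤ * -1ℤ * Q))
         + ((1ℤ * 1ℤ * R + (1ℤ * a + 1ℤ * a) * c + a * a * B) + S)) (ι-adjoint v′ α β) ⟩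
  (P + (a * a * A + (a * -1ℤ + a * -1ℤ) * ⟪ α , v′ ∧ β ⟫ + -1ℤ * -1ℤ * Q))
    + ((1ℤ * 1ℤ * R + (1ℤ * a + 1ℤ * a) * ⟪ α , v′ ∧ β ⟫ + a * a * B) + S)
    ≡⟨ regroup a A B P Q R S ⟪ α , v′ ∧ β ⟫ ⟩
  a * a * (A + B) + ((P + R) + (Q + S))
    ≡⟨ cong₂ (λ p q → a * a * (A + B) + (p + q)) (normSq-∧-ι v′ α) (normSq-∧-ι v′ β) ⟩
  a * a * (A + B) + (dot v′ v′ * A + dot v′ v′ * B)
    ≡⟨ collect a (dot v′ v′) A B ⟩
  (a * a + dot v′ v′) * (A + B) ∎
  where
  open ≡-Reasoning
  v′ = v ∘ suc
  a = v zero
  A = normSq α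
  B = normSq β
  P = normSq (v′ ∧ α)
  Q = normSq (v′ ∧ β)
  R = normSq (ι v′ α)
  S = normSq (ι v′ β)
  regroup : ∀ a A B P Q R S c →
    (P + (a * a * A + (a * -1ℤ + a * -1ℤ) * c + -1ℤ * -1ℤ * Q))
      + ((1ℤ * 1ℤ * R + (1ℤ * a + 1ℤ * a) * c + a * a * B) + S)
    ≡ a * a * (A + B) + ((P + R) + (Q + S))
  regroup = solve-∀
  collect : ∀ a d A B → a * a * (A + B) + (d * A + d * B) ≡ (a * a + d) * (A + B)
  collect = solve-∀

-- Norm bounds for one and for two wedge factors.

normSq-∧-≤ : ∀ {n} (v : Vector n) (x : Λ n) → normSq (v ∧ x) ≤ dot v v * normSq x
normSq-∧-≤ v x = begin
  normSq (v ∧ x)                   ≤⟨ i≤i+j _ _ {{nonNegative (0≤normSq (ι v x))}} ⟩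
  normSq (v ∧ x) + normSq (ι v x)  ≡⟨ normSq-∧-ι v x ⟩
  dot v v * normSq x               ∎
  where open ≤-Reasoning

-- The cross term is written `dot w v` so that, with u in the place of w, it reads `dot u v` in the
-- two-vector bound.
dot-lin : ∀ {n} a b (v w : Vector n) → let u = λ i → a * v i + b * w i in
  dot u u ≡ a * a * dot v v + (a * b + a * b) * dot w v + b * b * dot w w
dot-lin {zero}  a b _ _ = base a b
  where
  base : ∀ a b → 0ℤ ≡ a * a * 0ℤ + (a * b + a * b) * 0ℤ + b * b * 0ℤ
  base = solve-∀
dot-lin {suc n} a b v w =
  trans (cong (_+_ ((a * v zero + b * w zero) * (a * v zero + b * w zero))) (dot-lin a b v′ w′))
    (regroup a b (v zero) (w zero) (dot v′ v′) (dot w′ v′) (dot w′ w′))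
  where
  v′ = v ∘ suc
  w′ = w ∘ suc
  regroup : ∀ a b s t p q r →
    (a * s + b * t) * (a * s + b * t) + (a * a * p + (a * b + a * b) * q + b * b * r) ≡
    a * a * (s * s + p) + (a * b + a * b) * (t * s + q) + b * b * (t * t + r)
  regroup = solve-∀

-- A Gram-Schmidt step without division. With c = |u|², a = ⟨u,v⟩ and w = c v - a u, one has u ∧ w =
-- c (u ∧ v) and |w|² = c (c |v|² - a²). The one-vector bound for u and then w therefore gives the
-- claim multiplied by c², which positivity of c allows to cancel.
normSq-∧-∧-≤ : ∀ {n} (u v : Vector n) (x : Λ n) → 0ℤ < dot u u →
  normSq (u ∧ v ∧ x) ≤ (dot u u * dot v v - dot u v * dot u v) * normSq x
normSq-∧-∧-≤ u v x c>0 =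
  *-cancelˡ-≤-pos _ _ c (*-cancelˡ-≤-pos _ _ c (begin
    c * (c * normSq (u ∧ v ∧ x))                        ≡⟨ *-assoc c c _ ⟨
    c * c * normSq (u ∧ v ∧ x)                          ≡⟨ normSq-lin-zeroΛ c (- a) (u ∧ v ∧ x) ⟨
    -- The zero is inserted in order to be replaced by u ∧ u ∧ x; bilinearity then collects c v - a
    -- u into one factor.
    normSq (lin c (- a) (u ∧ v ∧ x) zeroΛ)              ≡⟨ cong (λ y → normSq (lin c (- a) (u ∧ v ∧ x) y)) (∧-self u x) ⟨
    normSq (lin c (- a) (u ∧ v ∧ x) (u ∧ u ∧ x))        ≡⟨ cong normSq (∧-lin u c (- a) (v ∧ x) (u ∧ x)) ⟨
    normSq (u ∧ lin c (- a) (v ∧ x) (u ∧ x))            ≡⟨ cong (λ y → normSq (u ∧ y)) (lin-∧ c (- a) v u x) ⟨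
    normSq (u ∧ w ∧ x)                                  ≤⟨ normSq-∧-≤ u (w ∧ x) ⟩
    c * normSq (w ∧ x)                                  ≤⟨ *-monoˡ-≤-nonNeg c (normSq-∧-≤ w x) ⟩
    c * (dot w w * normSq x)                            ≡⟨ cong (λ d → c * (d * normSq x)) (dot-lin c (- a) v u) ⟩
    c * ((c * c * dot v v + (c * - a + c * - a) * a + - a * - a * c) * normSq x)
                                                        ≡⟨ regroup c a (dot v v) (normSq x) ⟩
    c * (c * ((c * dot v v - a * a) * normSq x))        ∎))
  where
  open ≤-Reasoning
  c = dot u u
  a = dot u v
  w = λ i → c * v i + - a * u i
  instance
    c-pos = positive c>0
    c-nonNeg = nonNegative (<⇒≤ c>0)
  regroup : ∀ c a d N → c * ((c * c * d + (c * - a + c * - a) * a + - a * - a * c) * N) ≡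
    c * (c * ((c * d - a * a) * N))
  regroup = solve-∀

-- Reordering the factors of a wedge product.

infix 4 _≡±_
-- Squared norms do not see the sign, so the sign of a permutation need not be tracked.
_≡±_ : ∀ {n} → Λ n → Λ n → Set
x ≡± y = x ≡ y ⊎ x ≡ ⊖ y

≡±-trans : ∀ {n} {x y z : Λ n} → x ≡± y → y ≡± z → x ≡± z
≡±-trans (inj₁ refl) q           = q
≡±-trans (inj₂ refl) (inj₁ refl) = inj₂ refl
≡±-trans (inj₂ refl) (inj₂ refl) = inj₁ (⊖-involutive _)

∧-cong-≡± : ∀ {n} (v : Vector n) {x y : Λ n} → x ≡± y → v ∧ x ≡± v ∧ y
∧-cong-≡± v (inj₁ refl) = inj₁ refl
∧-cong-≡± v (inj₂ refl) = inj₂ (∧-lin v -1ℤ 0ℤ _ _)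

normSq-≡± : ∀ {n} {x y : Λ n} → x ≡± y → normSq x ≡ normSq y
normSq-≡± (inj₁ refl) = refl
normSq-≡± {y = y} (inj₂ refl) = normSq-⊖ y

⋀-↭ : ∀ {n} {vs ws : List (Vector n)} → vs ↭ ws → ⋀ vs ≡± ⋀ ws
⋀-↭ ↭.refl         = inj₁ refl
⋀-↭ (↭.prep v p)   = ∧-cong-≡± v (⋀-↭ p)
⋀-↭ (↭.swap v w p) = ≡±-trans (∧-cong-≡± v (∧-cong-≡± w (⋀-↭ p))) (inj₂ (∧-anticomm v w _))
⋀-↭ (↭.trans p q)  = ≡±-trans (⋀-↭ p) (⋀-↭ q)

-- Determinants as coefficients of the product of all basis vectors.

top : ∀ {n} → Λ n → ℤ
top {zero}  x       = x
top {suc n} (α , β) = top β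

-- The algebra morphism that kills the basis vector with index j.
kill : ∀ {n} → Fin (suc n) → Λ (suc n) → Λ n
kill         zero    (α , β) = α
kill {suc n} (suc j) (α , β) = kill j α , kill j β

top-lin : ∀ {n} a b (x y : Λ n) → top (lin a b x y) ≡ a * top x + b * top y
top-lin {zero}  a b x y = refl
top-lin {suc n} a b (_ , x) (_ , y) = top-lin a b x y

-- The top coefficient is one of the coordinates whose squares add up to the squared norm.
top²≤normSq : ∀ {n} (x : Λ n) → top x * top x ≤ normSq x
top²≤normSq {zero}  x = ≤-refl
top²≤normSq {suc n} (x , y) =
  subst (_≤ normSq (x , y)) (+-identityˡ (top y * top y)) (+-mono-≤ (0≤normSq x) (top²≤normSq y))

kill-lin : ∀ {n} j a b (x y : Λ (suc n)) → kill j (lin a b x y) ≡ lin a b (kill j x) (kill j y)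
kill-lin         zero    a b x y = refl
kill-lin {suc n} (suc j) a b (x , x′) (y , y′) = cong₂ _,_ (kill-lin j a b x y) (kill-lin j a b x′ y′)

kill-zeroΛ : ∀ {n} j → kill j zeroΛ ≡ zeroΛ {n}
kill-zeroΛ         zero    = refl
kill-zeroΛ {suc n} (suc j) = cong₂ _,_ (kill-zeroΛ j) (kill-zeroΛ j)

kill-oneΛ : ∀ {n} j → kill j oneΛ ≡ oneΛ {n}
kill-oneΛ         zero    = refl
kill-oneΛ {suc n} (suc j) = cong₂ _,_ (kill-oneΛ j) (kill-zeroΛ j)

-- On vectors the morphism deletes coordinate j, which is precomposition with `punchIn j`.
kill-∧ : ∀ {n} j (v : Vector (suc n)) (x : Λ (suc n)) → kill j (v ∧ x) ≡ (v ∘ punchIn j) ∧ kill j x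
kill-∧         zero    v x = refl
kill-∧ {suc n} (suc j) v (α , β) = cong₂ _,_ (kill-∧ j (v ∘ suc) α)
  (trans (kill-lin j (v zero) -1ℤ α _) (cong (lin _ _ _) (kill-∧ j (v ∘ suc) β)))

kill-⋀ : ∀ {n} j (vs : List (Vector (suc n))) → kill j (⋀ vs) ≡ ⋀ (map (_∘ punchIn j) vs)
kill-⋀ j []       = kill-oneΛ j
kill-⋀ j (v ∷ vs) = trans (kill-∧ j v (⋀ vs)) (cong (_ ∧_) (kill-⋀ j vs))

-- The summand v j e_j meets only the term of x that contains every basis vector but e_j, whose
-- coefficient is `top (kill j x)`. Moving e_j into place passes j smaller basis vectors, hence the
-- sign.
top-∧ : ∀ {n} (v : Vector (suc n)) (x : Λ (suc n)) →
  top (v ∧ x) ≡ sum +-*-semiring (λ j → -1ℤ ^ toℕ j * v j * top (kill j x))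
top-∧ {zero} v (α , β) = base (v zero) α
  where
  base : ∀ a x → a * x + -1ℤ * 0ℤ ≡ 1ℤ * a * x + 0ℤ
  base = solve-∀
top-∧ {suc n} v (α , β) = begin
  top (lin a -1ℤ α (v′ ∧ β))                   ≡⟨ top-lin a -1ℤ α (v′ ∧ β) ⟩
  a * top α + -1ℤ * top (v′ ∧ β)               ≡⟨ cong (λ t → a * top α + -1ℤ * t) (top-∧ v′ β) ⟩
  a * top α + -1ℤ * sum +-*-semiring (λ j → -1ℤ ^ toℕ j * v′ j * top (kill j β))
    -- The α term is the summand for j = 0; in the others the factor -1 raises the exponent from j
    -- to j + 1.
    ≡⟨ cong₂ _+_ (cong (_* top α) (sym (*-identityˡ a)))
         (trans (*-distribˡ-sum +-*-semiring {suc n} -1ℤ (λ j → -1ℤ ^ toℕ j * v′ j * top (kill j β)))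
                (sum-cong-≗ +-*-semiring {suc n} (λ j → regroup (-1ℤ ^ toℕ j) (v′ j) (top (kill j β))))) ⟩
  1ℤ * a * top α + sum +-*-semiring (λ j → -1ℤ ^ toℕ (suc j) * v′ j * top (kill j β)) ∎
  where
  open ≡-Reasoning
  v′ = v ∘ suc
  a = v zero
  regroup : ∀ s t r → -1ℤ * (s * t * r) ≡ -1ℤ * s * t * r
  regroup = solve-∀

-- Splitting off the first row by `top-∧` is the Laplace expansion: killing e_j in the wedge of the
-- other rows deletes column j, which leaves the minor.
det≡top-⋀ : ∀ {n} (A : Matrix n) → det A ≡ top (⋀ (tabulate A))
det≡top-⋀ {zero}  A = refl
det≡top-⋀ {suc n} A = sym (trans (top-∧ (A zero) _)
  (sum-cong-≗ +-*-semiring {suc n} λ j → cong (-1ℤ ^ toℕ j * A zero j *_) (minor j)))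
  where
  open ≡-Reasoning
  minor : ∀ j → top (kill j (⋀ (tabulate (A ∘ suc)))) ≡ det (λ i k → A (suc i) (punchIn j k))
  minor j = begin
    top (kill j (⋀ (tabulate (A ∘ suc))))                 ≡⟨ cong top (kill-⋀ j (tabulate (A ∘ suc))) ⟩
    top (⋀ (map (_∘ punchIn j) (tabulate (A ∘ suc))))     ≡⟨ cong (top ∘ ⋀) (map-tabulate (A ∘ suc) (_∘ punchIn j)) ⟩
    top (⋀ (tabulate (λ i → A (suc i) ∘ punchIn j)))      ≡⟨ det≡top-⋀ (λ i → A (suc i) ∘ punchIn j) ⟨
    det (λ i k → A (suc i) (punchIn j k))                 ∎

det²≤normSq-⋀ : ∀ {n} (A : Matrix n) {is : List (Fin n)} → allFin n ↭ is →
  det A * det A ≤ normSq (⋀ (map A is))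
det²≤normSq-⋀ {n} A {is} p = begin
  det A * det A                                      ≡⟨ cong (λ d → d * d) (det≡top-⋀ A) ⟩
  top (⋀ (tabulate A)) * top (⋀ (tabulate A))        ≤⟨ top²≤normSq (⋀ (tabulate A)) ⟩
  normSq (⋀ (tabulate A))                            ≡⟨ cong (normSq ∘ ⋀) (map-tabulate (λ i → i) A) ⟨
  normSq (⋀ (map A (allFin n)))                      ≡⟨ normSq-≡± (⋀-↭ (map⁺ A p)) ⟩
  normSq (⋀ (map A is))                              ∎
  where open ≤-Reasoning

-- Sums of indicators and sums with a single nonzero term.

indicator : Bool → ℤ
indicator b = if b then 1ℤ else 0ℤ

sum-indicator : ∀ {ℓ} {A : Set} {P : Pred A ℓ} (P? : Decidable P) {n} (f : Fin n → A) →
  sum +-*-semiring (λ i → indicator (does (P? (f i)))) ≡ + length (filter P? (tabulate f))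
sum-indicator P? {zero}  f = refl
sum-indicator P? {suc n} f with does (P? (f zero)) | sum-indicator P? (f ∘ suc)
... | true  | ih = cong (_+_ 1ℤ) ih
... | false | ih = cong (_+_ 0ℤ) ih

sum-single : ∀ {n} (t : Vector n) i → (∀ j → j ≢ i → t j ≡ 0ℤ) → sum +-*-semiring t ≡ t i
sum-single {suc n} t i t≡0 = begin
  sum +-*-semiring t                                    ≡⟨ sum-remove +-*-semiring {i = i} t ⟩
  t i + sum +-*-semiring (t ∘ punchIn i)
    ≡⟨ cong (_+_ (t i)) (trans (sum-cong-≗ +-*-semiring {n} (λ j → t≡0 _ (punchInᵢ≢i i j))) (sum-replicate-zero +-*-semiring n)) ⟩
  t i + 0ℤ                                              ≡⟨ +-identityʳ (t i) ⟩
  t i                                                   ∎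
  where open ≡-Reasoning

-- Listing the vertices so that matched pairs come first.

module _ {n : ℕ} where

  -- Partners stand next to each other, so the two-vector bound applies to their rows.
  endpoints : List (Edge n) → List (Fin n)
  endpoints []            = []
  endpoints ((u , v) ∷ M) = u ∷ v ∷ endpoints M

  ∈-endpoints⁻ : ∀ M {x} → x ∈ endpoints M → Covered M x
  ∈-endpoints⁻ (e ∷ M) (here p)          = here (inj₁ p)
  ∈-endpoints⁻ (e ∷ M) (there (here p))  = here (inj₂ p)
  ∈-endpoints⁻ (e ∷ M) (there (there p)) = there (∈-endpoints⁻ M p)

  ∈-endpoints⁺ : ∀ {M x} → Covered M x → x ∈ endpoints M
  ∈-endpoints⁺ (here (inj₁ p)) = here p
  ∈-endpoints⁺ (here (inj₂ p)) = there (here p)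
  ∈-endpoints⁺ (there p)       = there (there (∈-endpoints⁺ p))

  endpoints-unique : ∀ {M} → All (λ (u , v) → u ≢ v) M → AllPairs Disjoint M → Unique (endpoints M)
  endpoints-unique []         []       = []
  endpoints-unique {(u , v) ∷ M} (u≢v ∷ ps) (d ∷ ds) =
      (u≢v ∷ fresh (All.map proj₁ d))
    ∷ fresh (All.map proj₂ d)
    ∷ endpoints-unique ps ds
    where
    fresh : ∀ {x} → All (λ e → ¬ Incident x e) M → All (x ≢_) (endpoints M)
    fresh ¬inc = ¬Any⇒All¬ _ (All¬⇒¬Any ¬inc ∘ ∈-endpoints⁻ M)

  -- Both lists are free of repetitions and contain every vertex, so they are equal as bags and
  -- hence permutations of each other.
  allFin↭endpoints++uncovered : ∀ {M} → All (λ (u , v) → u ≢ v) M → AllPairs Disjoint M →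
    allFin n ↭ endpoints M ++ uncovered M
  allFin↭endpoints++uncovered {M} ps ds =
    ∼bag⇒↭ (unique∧set⇒bag (Unique.allFin⁺ n)
      (Unique.++⁺ (endpoints-unique ps ds) (Unique.filter⁺ _ (Unique.allFin⁺ n)) disjoint)
      (mk⇔ (λ _ → total _) (λ _ → ∈-allFin _)))
    where
    disjoint : ∀ {x} → ¬ (x ∈ endpoints M × x ∈ uncovered M)
    disjoint (p , q) = proj₂ (∈-filter⁻ (λ v → ¬? (covered? M v)) {xs = allFin n} q) (∈-endpoints⁻ M p)
    total : ∀ x → x ∈ endpoints M ++ uncovered M
    total x with covered? M x
    ... | yes c = ∈-++⁺ˡ (∈-endpoints⁺ c)
    ... | no ¬c = ∈-++⁺ʳ (endpoints M) (∈-filter⁺ (λ v → ¬? (covered? M v)) (∈-allFin x) ¬c)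

-- Rows of the skew adjacency matrix and their inner products.

module _ {n : ℕ} {G : Graph n} (O : Orientation G) where
  open Graph G
  open Orientation O using (_⇒_; _⇒?_; ⇒-edge; ⇒-some)

  private
    S : Matrix n
    S = skewAdjacency O

  S-nonadjacent : ∀ {u v} → ¬ u ~ v → S u v ≡ 0ℤ
  S-nonadjacent {u} {v} u≁v
    rewrite dec-false (u ⇒? v) (u≁v ∘ ⇒-edge) | dec-false (v ⇒? u) (u≁v ∘ ~-sym ∘ ⇒-edge) = refl

  S-adjacent : ∀ {u v} → u ~ v → S u v * S u v ≡ 1ℤ
  S-adjacent {u} {v} u~v with u ⇒? v | v ⇒? u
  ... | yes _  | _      = refl
  ... | no _   | yes _  = refl
  ... | no u⇏v | no v⇏u with ⇒-some u~v
  ...   | inj₁ p = ⊥-elim (u⇏v p)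
  ...   | inj₂ p = ⊥-elim (v⇏u p)

  S-square : ∀ u v → S u v * S u v ≡ indicator (does (u ~? v))
  S-square u v with u ~? v
  ... | yes p = S-adjacent p
  ... | no ¬p = cong (λ s → s * s) (S-nonadjacent ¬p)

  -- The squares of the entries forget the orientation and mark the neighbours of u.
  dot-S-self : ∀ u → dot (S u) (S u) ≡ + deg G u
  dot-S-self u = trans (sum-cong-≗ +-*-semiring (S-square u)) (sum-indicator (u ~?_) (λ i → i))

  0<deg : ∀ {u v} → u ~ v → 0 ℕ.< deg G u
  0<deg {u} {v} u~v = ∈-length (∈-filter⁺ (u ~?_) (∈-allFin v) u~v)

  module _ (no4 : No4Cycles G) where

    -- Otherwise u, w, v, x would form a 4-cycle. The hypothesis only refutes x ≢ w; decidability of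
    -- equality turns this into x ≡ w.
    common-neighbour-unique : ∀ {u v w x} → u ≢ v → u ~ w → w ~ v → u ~ x → x ~ v → x ≡ w
    common-neighbour-unique {u} {v} {w} {x} u≢v uw wv ux xv = decidable-stable (x ≟ w) λ x≢w →
      no4 u w v x (((uw ∷ wv ∷ ~-sym xv ∷ [-])
        , ((irr uw ∷ u≢v ∷ irr ux ∷ []) ∷ (irr wv ∷ ≢-sym x≢w ∷ []) ∷ (≢-sym (irr xv) ∷ []) ∷ [] ∷ []))
        , ~-sym ux)
      where
      irr : ∀ {a b} → a ~ b → a ≢ b
      irr p q = ~-irrefl q p

    -- Only the single common neighbour w contributes, with a product of two entries ±1. Squaring
    -- removes the unknown sign.
    dot-S-pair : ∀ {u v} → Graph._~_ (pathOfLength2Graph G) u v → dot (S u) (S v) * dot (S u) (S v) ≡ 1ℤ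
    dot-S-pair {u} {v} (u≢v , w , (uw ∷ wv ∷ [-]) , _) = begin
      dot (S u) (S v) * dot (S u) (S v)      ≡⟨ cong (λ d → d * d) (sum-single _ w elsewhere) ⟩
      (S u w * S v w) * (S u w * S v w)      ≡⟨ regroup (S u w) (S v w) ⟩
      (S u w * S u w) * (S v w * S v w)      ≡⟨ cong₂ _*_ (S-adjacent uw) (S-adjacent (~-sym wv)) ⟩
      1ℤ                                     ∎
      where
      open ≡-Reasoning
      regroup : ∀ a b → (a * b) * (a * b) ≡ (a * a) * (b * b)
      regroup = solve-∀
      elsewhere : ∀ x → x ≢ w → S u x * S v x ≡ 0ℤ
      elsewhere x x≢w with u ~? x | v ~? x
      ... | no ¬ux | _      = cong (_* S v x) (S-nonadjacent ¬ux)
      ... | yes _  | no ¬vx = trans (cong (S u x *_) (S-nonadjacent ¬vx)) (*-zeroʳ (S u x))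
      ... | yes ux | yes vx = ⊥-elim (x≢w (common-neighbour-unique u≢v uw wv ux (~-sym vx)))

    -- The two-vector bound removes one matched pair of rows at a time, then the one-vector bound
    -- removes the remaining rows singly. All factors are nonnegative, so the bounds multiply.
    normSq-⋀-S-≤ : ∀ {M} → All (λ (u , v) → Graph._~_ (pathOfLength2Graph G) u v) M → ∀ ws →
      normSq (⋀ (map S (endpoints M ++ ws))) ≤
      ∏ M (λ (u , v) → + deg G u * + deg G v - 1ℤ) * ∏ ws (λ v → + deg G v)
    normSq-⋀-S-≤ [] [] = ≤-reflexive (normSq-oneΛ {n})
    normSq-⋀-S-≤ [] (w ∷ ws) = begin
      normSq (S w ∧ ⋀ (map S ws))                             ≤⟨ normSq-∧-≤ (S w) _ ⟩
      dot (S w) (S w) * normSq (⋀ (map S ws))                 ≡⟨ cong (_* normSq (⋀ (map S ws))) (dot-S-self w) ⟩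
      + deg G w * normSq (⋀ (map S ws))                       ≤⟨ *-monoˡ-≤-nonNeg (+ deg G w) (normSq-⋀-S-≤ [] ws) ⟩
      + deg G w * (1ℤ * ∏ ws (λ v → + deg G v))               ≡⟨ regroup (+ deg G w) _ ⟩
      1ℤ * (+ deg G w * ∏ ws (λ v → + deg G v))               ∎
      where
      open ≤-Reasoning
      regroup : ∀ a b → a * (1ℤ * b) ≡ 1ℤ * (a * b)
      regroup = solve-∀
    normSq-⋀-S-≤ {(u , v) ∷ M} (u~v@(_ , _ , (uw ∷ wv ∷ [-]) , _) ∷ ps) ws = begin
      normSq (S u ∧ S v ∧ x)
        -- The middle vertex w of the path is a neighbour of u, so |S u|² = d(u) is positive.
        ≤⟨ normSq-∧-∧-≤ (S u) (S v) x (subst (0ℤ <_) (sym (dot-S-self u)) (+<+ (0<deg uw))) ⟩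
      (dot (S u) (S u) * dot (S v) (S v) - dot (S u) (S v) * dot (S u) (S v)) * normSq x
        ≡⟨ cong (_* normSq x) (cong₂ _-_ (cong₂ _*_ (dot-S-self u) (dot-S-self v)) (dot-S-pair u~v)) ⟩
      k * normSq x                           ≤⟨ *-monoˡ-≤-nonNeg k {{nonNegative 0≤k}} (normSq-⋀-S-≤ ps ws) ⟩
      k * (∏ M f * ∏ ws (λ v → + deg G v))   ≡⟨ *-assoc k (∏ M f) _ ⟨
      k * ∏ M f * ∏ ws (λ v → + deg G v)     ∎
      where
      open ≤-Reasoning
      x = ⋀ (map S (endpoints M ++ ws))
      f : Edge n → ℤ
      f (u , v) = + deg G u * + deg G v - 1ℤ
      k = f (u , v)
      0≤k : 0ℤ ≤ k
      -- Both u and v are adjacent to w, so d(u) d(v) is at least 1.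
      0≤k = i≤j⇒0≤j-i (subst (1ℤ ≤_) (pos-* (deg G u) (deg G v))
        (+≤+ (ℕ.*-mono-≤ (0<deg uw) (0<deg (~-sym wv)))))

theorem5p1 : ∀ {n : ℕ} (G : Graph n) → Connected G → Pfaffian G → No4Cycles G →
    (M′ : List (Edge n)) → IsMatching (pathOfLength2Graph G) M′ →
    (+ perfmat G) ^ 4 ≤
    ∏ M′ (λ (u , v) → + deg G u * + deg G v - 1ℤ) * ∏ (uncovered M′) (λ v → + deg G v)
theorem5p1 G _ (O , det≡) no4 M′ (paths , disjoint) = begin
  (+ p) ^ 4                                                                   ≡⟨ regroup (+ p) ⟩
  (+ p * + p) * (+ p * + p)                                                   ≡⟨ cong (λ d → d * d) det-S ⟨
  det S * det S                                                               ≤⟨ det²≤normSq-⋀ S order ⟩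
  normSq (⋀ (map S (endpoints M′ ++ uncovered M′)))                           ≤⟨ normSq-⋀-S-≤ O no4 paths (uncovered M′) ⟩
  ∏ M′ (λ (u , v) → + deg G u * + deg G v - 1ℤ) * ∏ (uncovered M′) (λ v → + deg G v) ∎
  where
  open ≤-Reasoning
  p = perfmat G
  S = skewAdjacency O
  order = allFin↭endpoints++uncovered (All.map proj₁ paths) disjoint
  -- The left side is the form to which the fourth power unfolds, with its final factor 1.
  regroup : ∀ a → a * (a * (a * (a * 1ℤ))) ≡ (a * a) * (a * a)
  regroup = solve-∀
  det-S : det S ≡ + p * + p
  det-S = trans det≡ (trans (cong (λ k → + (p ℕ.* k)) (ℕ.*-identityʳ p)) (pos-* p p))
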